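{- For every $k \in \mathbb{N}$ we have $\mathrm{N}(k) = k + \lfloor \log_2(k + 1 + \lfloor \log_2(k+1) \rfloor) \rfloor$.
   Context: The function $\mathrm{N} : \mathbb{N} \to \mathbb{N}$, $\mathbb{N} = \{1,2,\dots\}$, is defined recursively by $\mathrm{N}(1) = 2$ and, for $k \ge 2$, $\mathrm{N}(k) = \max_{i \in \{2,\dots,k\}} \min(2i, \mathrm{N}(k-i+1) + i)$. -}

module Defs where

open import Data.Nat.Base
  using (ℕ; suc; _+_; _*_; _∸_; _⊓_; _≤_; _<_; s≤s)
open import Data.Nat.Properties
  using (+-comm; m∸n≤m; ≤-reflexive; ≤-trans)
open import Data.Nat.Induction using (<-Rec; <-rec; <-wellFounded)
open import Data.List.Base using (List; map; upTo)
open import Data.List.Properties using (map-cong; map-∘)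
open import Data.List.Extrema.Nat using (max)
open import Induction.WellFounded using (module FixPoint)
open import Relation.Binary.PropositionalEquality
  using (_≡_; refl; cong; trans)

index-decreases : ∀ m j → (2 + m) ∸ (2 + j) + 1 < 2 + m
index-decreases m j =
  s≤s (≤-trans (≤-reflexive (+-comm (m ∸ j) 1)) (s≤s (m∸n≤m m j)))

-- For k = 2 + m, the index i = 2 + j runs over {2,…,k} as j runs over
-- {0,…,m}.  The list is non-empty, so the default value 0 of max does not
-- affect the maximum.
N-step : ∀ k → <-Rec (λ _ → ℕ) k → ℕ
N-step 0             N< = 0
N-step 1             N< = 2
N-step (suc (suc m)) N< = max 0 (map term (upTo (suc m)))
  where
  term : ℕ → ℕ
  term j = let k = 2 + m ; i = 2 + j in
    (2 * i) ⊓ (N< {k ∸ i + 1} (index-decreases m j) + i)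

-- Only the values at k ≥ 1 are meaningful; N 0 = 0 is a dummy value, which
-- the recursion never uses, as k ∸ i + 1 ≥ 1.
N : ℕ → ℕ
N = <-rec (λ _ → ℕ) N-step

[2‥_] : ℕ → List ℕ
[2‥ k ] = map (2 +_) (upTo (k ∸ 1))

N-1 : N 1 ≡ 2
N-1 = refl

N-rec : ∀ k → 2 ≤ k →
        N k ≡ max 0 (map (λ i → (2 * i) ⊓ (N (k ∸ i + 1) + i)) [2‥ k ])
N-rec (suc (suc m)) _ = trans (unfold-wfRec {2 + m})
                              (cong (max 0) (map-∘ (upTo (suc m))))
  where
  N-step-ext : ∀ k {f g : <-Rec (λ _ → ℕ) k} →
               (∀ {l} (l<k : l < k) → f l<k ≡ g l<k) →
               N-step k f ≡ N-step k g
  N-step-ext 0             f≡g = refl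
  N-step-ext 1             f≡g = refl
  N-step-ext (suc (suc m)) f≡g = cong (max 0)
    (map-cong (λ j → cong (λ x → (2 * (2 + j)) ⊓ (x + (2 + j)))
                          (f≡g (index-decreases m j)))
              (upTo (suc m)))

  open FixPoint <-wellFounded (λ _ → ℕ) N-step N-step-ext using (unfold-wfRec)
N-rec 1 (s≤s ())

-- Write gain k = ⌊log₂ (k + 1 + ⌊log₂ (k + 1)⌋)⌋.  For k ≥ 1 it is determined
-- by: t ≤ gain k iff 2 ^ t ≤ k + t.  Put t = gain k and l = k − i + 1, and
-- assume N l = l + gain l for all l < k, so that the second argument of the
-- minimum is k + 1 + gain l.  If it exceeds k + t, then t ≤ gain l, and
-- 2 ^ (t + 1) > k + t + 1 forces 2 i ≤ k + t; hence N k ≤ k + t.  For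
-- i = ⌈(k + t) / 2⌉ both arguments are at least k + t; hence N k ≥ k + t.

{-# OPTIONS --safe #-}
module Submission where

open import Defs using (N; [2‥_]; N-rec)
open import Data.Nat.Base
open import Data.Nat.Induction using (<-rec)
open import Data.Nat.Logarithm
  using (⌊log₂_⌋; ⌊log₂⌋-mono-≤; ⌊log₂⌊n/2⌋⌋≡⌊log₂n⌋∸1; ⌊log₂[2^n]⌋≡n)
open import Data.Nat.Properties
open import Data.List.Base using (map)
open import Data.List.Extrema.Nat using (max; max≤v⁺; xs≤max)
open import Data.List.Membership.Propositional.Properties using (∈-map⁺; ∈-upTo⁺)
import Data.List.Relation.Unary.All as All
import Data.List.Relation.Unary.All.Properties as All
open import Relation.Binary.PropositionalEquality
  using (_≡_; refl; sym; trans; cong; subst)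
open import Relation.Nullary using (yes; no)

2*n≡n+n : ∀ n → 2 * n ≡ n + n
2*n≡n+n n = cong (n +_) (+-identityʳ n)

n<2^n : ∀ n → n < 2 ^ n
n<2^n zero    = z<s
n<2^n (suc n) = begin-strict
  suc n          ≤⟨ n<2^n n ⟩
  2 ^ n          <⟨ m<m+n (2 ^ n) (m^n>0 2 n) ⟩
  2 ^ n + 2 ^ n  ≡⟨ 2*n≡n+n (2 ^ n) ⟨
  2 ^ suc n      ∎
  where open ≤-Reasoning

2*m≤n⇒m≤⌊n/2⌋ : ∀ {m n} → 2 * m ≤ n → m ≤ ⌊ n /2⌋
2*m≤n⇒m≤⌊n/2⌋ {m} {n} 2*m≤n = begin
  m            ≡⟨ n≡⌊n+n/2⌋ m ⟩
  ⌊ m + m /2⌋  ≤⟨ ⌊n/2⌋-mono (subst (_≤ n) (2*n≡n+n m) 2*m≤n) ⟩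
  ⌊ n /2⌋      ∎
  where open ≤-Reasoning

m≤⌊n/2⌋⇒2*m≤n : ∀ {m n} → m ≤ ⌊ n /2⌋ → 2 * m ≤ n
m≤⌊n/2⌋⇒2*m≤n {m} {n} m≤ = begin
  2 * m              ≡⟨ 2*n≡n+n m ⟩
  m + m              ≤⟨ +-mono-≤ m≤ (≤-trans m≤ (⌊n/2⌋≤⌈n/2⌉ n)) ⟩
  ⌊ n /2⌋ + ⌈ n /2⌉  ≡⟨ ⌊n/2⌋+⌈n/2⌉≡n n ⟩
  n                  ∎
  where open ≤-Reasoning

n≤2*⌈n/2⌉ : ∀ n → n ≤ 2 * ⌈ n /2⌉
n≤2*⌈n/2⌉ n = begin
  n                  ≡⟨ ⌊n/2⌋+⌈n/2⌉≡n n ⟨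
  ⌊ n /2⌋ + ⌈ n /2⌉  ≤⟨ +-monoˡ-≤ ⌈ n /2⌉ (⌊n/2⌋≤⌈n/2⌉ n) ⟩
  ⌈ n /2⌉ + ⌈ n /2⌉  ≡⟨ 2*n≡n+n ⌈ n /2⌉ ⟨
  2 * ⌈ n /2⌉        ∎
  where open ≤-Reasoning

2^t≤n⇒t≤⌊log₂n⌋ : ∀ {t n} → 2 ^ t ≤ n → t ≤ ⌊log₂ n ⌋
2^t≤n⇒t≤⌊log₂n⌋ {t} {n} 2^t≤n =
  subst (_≤ ⌊log₂ n ⌋) (⌊log₂[2^n]⌋≡n t) (⌊log₂⌋-mono-≤ 2^t≤n)

-- Induction on `t`: halving `n` lowers its logarithm by one. The hypothesis `1 ≤ n` excludes
-- `⌊log₂ 0 ⌋`, which is 0 by convention.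
t≤⌊log₂n⌋⇒2^t≤n : ∀ t {n} → 1 ≤ n → t ≤ ⌊log₂ n ⌋ → 2 ^ t ≤ n
t≤⌊log₂n⌋⇒2^t≤n zero    {n}     1≤n _   = 1≤n
t≤⌊log₂n⌋⇒2^t≤n (suc t) {1}     _   ()
t≤⌊log₂n⌋⇒2^t≤n (suc t) {n@(suc (suc _))} _ t<log =
  m≤⌊n/2⌋⇒2*m≤n (t≤⌊log₂n⌋⇒2^t≤n t (s≤s z≤n)
    (subst (t ≤_) (sym (⌊log₂⌊n/2⌋⌋≡⌊log₂n⌋∸1 n)) (∸-monoˡ-≤ 1 t<log)))

gain : ℕ → ℕ
gain k = ⌊log₂ (k + 1 + ⌊log₂ (k + 1) ⌋) ⌋

-- For an exponent `suc t`, cancelling `t < 2 ^ t` from the hypothesis leaves `2 ^ t ≤ k + 1`. So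
-- the inner logarithm is at least `t`, and the argument of the outer one is at least `2 ^ suc t`.
2^t≤k+t⇒t≤gain : ∀ t k → 2 ^ t ≤ k + t → t ≤ gain k
2^t≤k+t⇒t≤gain zero    k _     = z≤n
2^t≤k+t⇒t≤gain (suc t) k 2^t≤k+t = 2^t≤n⇒t≤⌊log₂n⌋ (begin
  2 ^ suc t                 ≤⟨ 2^t≤k+t ⟩
  k + (1 + t)               ≡⟨ +-assoc k 1 t ⟨
  k + 1 + t                 ≤⟨ +-monoʳ-≤ (k + 1) (2^t≤n⇒t≤⌊log₂n⌋ 2^t≤k+1) ⟩
  k + 1 + ⌊log₂ (k + 1) ⌋   ∎)
  where
  open ≤-Reasoning
  2^t≤k+1 : 2 ^ t ≤ k + 1
  2^t≤k+1 = +-cancelʳ-≤ (2 ^ t) (2 ^ t) (k + 1) (begin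
    2 ^ t + 2 ^ t  ≡⟨ 2*n≡n+n (2 ^ t) ⟨
    2 ^ suc t      ≤⟨ 2^t≤k+t ⟩
    k + (1 + t)    ≡⟨ +-assoc k 1 t ⟨
    k + 1 + t      ≤⟨ +-monoʳ-≤ (k + 1) (<⇒≤ (n<2^n t)) ⟩
    k + 1 + 2 ^ t  ∎)

-- If the inner logarithm is at least `t`, then already `2 ^ t ≤ k + 1`. Otherwise it is at most
-- `t - 1`, so the argument of the outer logarithm is at most `k + t`.
t≤gain⇒2^t≤k+t : ∀ t {k} → 1 ≤ k → t ≤ gain k → 2 ^ t ≤ k + t
t≤gain⇒2^t≤k+t zero            1≤k _ = m≤n⇒m≤n+o 0 1≤k
t≤gain⇒2^t≤k+t t@(suc s) {k} 1≤k t≤gain with t ≤? ⌊log₂ (k + 1) ⌋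
... | yes t≤log = begin
  2 ^ t  ≤⟨ t≤⌊log₂n⌋⇒2^t≤n t (m≤n+m 1 k) t≤log ⟩
  k + 1  ≤⟨ +-monoʳ-≤ k (s≤s z≤n) ⟩
  k + t  ∎
  where open ≤-Reasoning
... | no t≰log = begin
  2 ^ t                    ≤⟨ t≤⌊log₂n⌋⇒2^t≤n t 1≤arg t≤gain ⟩
  k + 1 + ⌊log₂ (k + 1) ⌋  ≤⟨ +-monoʳ-≤ (k + 1) (s≤s⁻¹ (≰⇒> t≰log)) ⟩
  k + 1 + s                ≡⟨ +-assoc k 1 s ⟩
  k + t                    ∎
  where
  open ≤-Reasoning
  1≤arg : 1 ≤ k + 1 + ⌊log₂ (k + 1) ⌋
  1≤arg = m≤n⇒m≤n+o _ (m≤n+m 1 k)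

max≤v : ∀ (f : ℕ → ℕ) k {v} → 2 ≤ k → (∀ i → 2 ≤ i → i ≤ k → f i ≤ v) →
        max 0 (map f [2‥ k ]) ≤ v
max≤v f (suc (suc m)) _ f≤v =
  -- `z≤n` bounds the default value 0; the two `All.map⁺` undo `f` and the shift by 2 inside
  -- `[2‥_]`.
  max≤v⁺ z≤n (All.map⁺ (All.map⁺
    (All.map (λ j<1+m → f≤v _ (s≤s (s≤s z≤n)) (s≤s j<1+m))
             (All.all-upTo (suc m)))))
max≤v f 1 (s≤s ())

f≤max : ∀ (f : ℕ → ℕ) {i k} → 2 ≤ i → i ≤ k → f i ≤ max 0 (map f [2‥ k ])
f≤max f {suc (suc j)} {suc (suc m)} _ (s≤s j<1+m) =
  All.lookup (xs≤max 0 (map f [2‥ 2 + m ]))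
             (∈-map⁺ f (∈-map⁺ (2 +_) (∈-upTo⁺ j<1+m)))
f≤max f {1} (s≤s ()) _

-- Here `d` stands for `k ∸ i`, so that `k` is `i + d` without truncated subtraction. If the gain at
-- `suc d` is smaller than at `i + d`, the second argument of the minimum is small enough; otherwise
-- the first is.
term≤ : ∀ i d →
        (2 * i) ⊓ (suc d + gain (suc d) + i) ≤ i + d + gain (i + d)
term≤ i d with gain (i + d) ≤? gain (suc d)
... | no t≰ = m≤n⇒o⊓m≤n (2 * i) (begin
  suc d + gain (suc d) + i    ≡⟨ +-comm (suc d + gain (suc d)) i ⟩
  i + (suc d + gain (suc d))  ≡⟨ cong (i +_) (+-suc d (gain (suc d))) ⟨
  i + (d + suc (gain (suc d)))  ≤⟨ +-monoʳ-≤ i (+-monoʳ-≤ d (≰⇒> t≰)) ⟩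
  i + (d + gain (i + d))      ≡⟨ +-assoc i d _ ⟨
  i + d + gain (i + d)        ∎)
  where open ≤-Reasoning
... | yes t≤ = m≤n⇒m⊓o≤n _ (begin
  2 * i                 ≡⟨ 2*n≡n+n i ⟩
  i + i                 ≤⟨ +-monoʳ-≤ i (≮⇒≥ d+t≮i) ⟩
  i + (d + t)           ≡⟨ +-assoc i d t ⟨
  i + d + t             ∎)
  where
  open ≤-Reasoning
  t = gain (i + d)
  d+t≮i : d + t ≮ i
  -- Doubling `2 ^ t ≤ suc d + t` and replacing one summand by `i` would give
  -- `2 ^ suc t ≤ i + d + suc t`, hence `suc t ≤ t`.
  d+t≮i d+t<i = <-irrefl refl (2^t≤k+t⇒t≤gain (suc t) (i + d) (begin
    2 * 2 ^ t                  ≤⟨ *-monoʳ-≤ 2 (t≤gain⇒2^t≤k+t t (s≤s z≤n) t≤) ⟩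
    2 * (suc d + t)            ≡⟨ 2*n≡n+n (suc d + t) ⟩
    suc d + t + (suc d + t)    ≤⟨ +-monoˡ-≤ (suc d + t) d+t<i ⟩
    i + (suc d + t)            ≡⟨ cong (i +_) (+-suc d t) ⟨
    i + (d + suc t)            ≡⟨ +-assoc i d (suc t) ⟨
    i + d + suc t              ∎))

module Optimum (k : ℕ) (2≤k : 2 ≤ k) where
  open ≤-Reasoning

  t i : ℕ
  t = gain k
  -- The least index whose double reaches `k + t`; it keeps the recursive argument as large as
  -- possible.
  i = ⌈ k + t /2⌉

  1≤k : 1 ≤ k
  1≤k = <⇒≤ 2≤k

  1≤t : 1 ≤ t
  1≤t = 2^t≤k+t⇒t≤gain 1 k (+-monoˡ-≤ 1 1≤k)

  2^[t-1]≤⌊[k+t]/2⌋ : 2 ^ pred t ≤ ⌊ k + t /2⌋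
  2^[t-1]≤⌊[k+t]/2⌋ = 2*m≤n⇒m≤⌊n/2⌋ (begin
    2 ^ suc (pred t)  ≡⟨ cong (2 ^_) (suc-pred t {{>-nonZero 1≤t}}) ⟩
    2 ^ t             ≤⟨ t≤gain⇒2^t≤k+t t 1≤k ≤-refl ⟩
    k + t             ∎)

  2≤i : 2 ≤ i
  -- `k + t` is at least 3, and `⌈ 3 /2⌉` computes to 2.
  2≤i = ⌈n/2⌉-mono {3} (+-mono-≤ 2≤k 1≤t)

  -- Since the two halves of `k + t` add up to it, this amounts to `t ≤ ⌊ k + t /2⌋`, which follows
  -- from `pred t < 2 ^ pred t`.
  i≤k : i ≤ k
  i≤k = +-cancelʳ-≤ t i k (begin
    i + t              ≡⟨ cong (i +_) (suc-pred t {{>-nonZero 1≤t}}) ⟨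
    i + suc (pred t)   ≤⟨ +-monoʳ-≤ i (n<2^n (pred t)) ⟩
    i + 2 ^ pred t     ≤⟨ +-monoʳ-≤ i 2^[t-1]≤⌊[k+t]/2⌋ ⟩
    i + ⌊ k + t /2⌋    ≡⟨ +-comm i _ ⟩
    ⌊ k + t /2⌋ + i    ≡⟨ ⌊n/2⌋+⌈n/2⌉≡n (k + t) ⟩
    k + t              ∎)

  ⌊[k+t]/2⌋≡k-i+t : ⌊ k + t /2⌋ ≡ k ∸ i + t
  ⌊[k+t]/2⌋≡k-i+t = +-cancelˡ-≡ i _ _ (begin-equality
    i + ⌊ k + t /2⌋    ≡⟨ +-comm i _ ⟩
    ⌊ k + t /2⌋ + i    ≡⟨ ⌊n/2⌋+⌈n/2⌉≡n (k + t) ⟩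
    k + t              ≡⟨ cong (_+ t) (m+[n∸m]≡n i≤k) ⟨
    i + (k ∸ i) + t    ≡⟨ +-assoc i (k ∸ i) t ⟩
    i + (k ∸ i + t)    ∎)

  -- Passing from `k` to `k ∸ i + 1` costs at most one unit of gain: halving `2 ^ t ≤ k + t` gives
  -- the criterion for `pred t` at the new argument.
  t≤1+gain : t ≤ suc (gain (suc (k ∸ i)))
  t≤1+gain = begin
    t                         ≡⟨ suc-pred t {{>-nonZero 1≤t}} ⟨
    suc (pred t)              ≤⟨ s≤s (2^t≤k+t⇒t≤gain (pred t) (suc (k ∸ i)) (begin
      2 ^ pred t                ≤⟨ 2^[t-1]≤⌊[k+t]/2⌋ ⟩
      ⌊ k + t /2⌋               ≡⟨ ⌊[k+t]/2⌋≡k-i+t ⟩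
      k ∸ i + t                 ≡⟨ cong (k ∸ i +_) (suc-pred t {{>-nonZero 1≤t}}) ⟨
      k ∸ i + suc (pred t)      ≡⟨ +-suc (k ∸ i) (pred t) ⟩
      suc (k ∸ i) + pred t      ∎)) ⟩
    suc (gain (suc (k ∸ i)))  ∎

  -- The extra 1 in `suc (k ∸ i)` makes up for the unit of gain that may be lost.
  ≤term : k + t ≤ (2 * i) ⊓ (suc (k ∸ i) + gain (suc (k ∸ i)) + i)
  ≤term = ⊓-glb (n≤2*⌈n/2⌉ (k + t)) (begin
    k + t                                    ≤⟨ +-monoʳ-≤ k t≤1+gain ⟩
    k + suc (gain (suc (k ∸ i)))             ≡⟨ cong (_+ suc (gain (suc (k ∸ i)))) (m+[n∸m]≡n i≤k) ⟨
    i + (k ∸ i) + suc (gain (suc (k ∸ i)))   ≡⟨ +-assoc i (k ∸ i) _ ⟩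
    i + (k ∸ i + suc (gain (suc (k ∸ i))))   ≡⟨ cong (i +_) (+-suc (k ∸ i) _) ⟩
    i + (suc (k ∸ i) + gain (suc (k ∸ i)))   ≡⟨ +-comm i _ ⟩
    suc (k ∸ i) + gain (suc (k ∸ i)) + i     ∎)

N≡k+gain : ∀ k → 1 ≤ k → N k ≡ k + gain k
N≡k+gain = <-rec _ step
  where
  step : ∀ k → (∀ {l} → l < k → 1 ≤ l → N l ≡ l + gain l) → 1 ≤ k → N k ≡ k + gain k
  -- Both sides compute to 2.
  step 1 _ _ = refl
  step k@(suc (suc _)) ih _ =
    trans (N-rec k (s≤s (s≤s z≤n))) (≤-antisym upper lower)
    where
    open ≤-Reasoning

    term : ℕ → ℕ
    term i = (2 * i) ⊓ (N (k ∸ i + 1) + i)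

    term≡ : ∀ {i} → 2 ≤ i → i ≤ k →
            term i ≡ (2 * i) ⊓ (suc (k ∸ i) + gain (suc (k ∸ i)) + i)
    term≡ {i} 2≤i i≤k = cong (λ n → (2 * i) ⊓ (n + i))
      (trans (cong N (+-comm (k ∸ i) 1))
             -- The recursive argument `suc (k ∸ i)` is below `k` exactly because `i` is at least 2.
             (ih (≤-trans (+-monoˡ-≤ (k ∸ i) 2≤i) (≤-reflexive (m+[n∸m]≡n i≤k))) (s≤s z≤n)))

    upper : max 0 (map term [2‥ k ]) ≤ k + gain k
    upper = max≤v term k (s≤s (s≤s z≤n)) λ i 2≤i i≤k → begin
      term i                                                ≡⟨ term≡ 2≤i i≤k ⟩
      (2 * i) ⊓ (suc (k ∸ i) + gain (suc (k ∸ i)) + i)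
        ≤⟨ term≤ i (k ∸ i) ⟩
      i + (k ∸ i) + gain (i + (k ∸ i))  ≡⟨ cong (λ n → n + gain n) (m+[n∸m]≡n i≤k) ⟩
      k + gain k                                            ∎

    lower : k + gain k ≤ max 0 (map term [2‥ k ])
    lower = begin
      k + gain k                 ≤⟨ ≤term ⟩
      _                          ≡⟨ term≡ 2≤i i≤k ⟨
      term i                     ≤⟨ f≤max term 2≤i i≤k ⟩
      max 0 (map term [2‥ k ])   ∎
      where open Optimum k (s≤s (s≤s z≤n)) using (i; 2≤i; i≤k; ≤term)

theorem7p21 : (k : ℕ) → .{{_ : NonZero k}} →
    N k ≡ k + ⌊log₂ (k + 1 + ⌊log₂ (k + 1) ⌋) ⌋
theorem7p21 k = N≡k+gain k (>-nonZero⁻¹ k)
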